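{- For any non-empty labeled poset $(P,\omega)$, $$\tilde e(P,\omega;\lambda)=\sum_{k=1}^{\infty}a_k(P,\omega)\lambda^k=\frac1{1-\lambda}\sum_{k=1}^{|P|}c_k(P,\omega)\Bigl(\frac{\lambda}{1-\lambda}\Bigr)^k$$ (as formal power series in $\lambda$) and $$e(P,\omega;\lambda)=\sum_{k=1}^{|P|}c_k(P,\omega)\lambda^k(1-\lambda)^{|P|-k}.$$
   Context: All posets are finite and $\mathbb N^+=\{1,2,\dots\}$, $[n]=\{1,\dots,n\}$. An ideal of a poset $P$ is a down-closed subset (including $\emptyset$ and $P$). A labeled poset $(P,\omega)$ is a finite poset $P$ with an injective map $\omega:P\to\mathbb N^+$. A subset $S\subseteq P$ is $\omega$-natural if $\omega|_S$ is order-preserving ($\emptyset$ is $\omega$-natural). A map $f:P\to[n]$ is $\omega$-order-preserving if it is order-preserving and $f(x)>f(y)$ whenever $x>y$ in $P$ and $\omega(x)<\omega(y)$. The order polynomial $\Omega(P,\omega;t)$ is the unique polynomial in $t$ whose value at each $n\in\mathbb N^+$ is the number of $\omega$-order-preserving maps $P\to[n]$. The Eulerian polynomial $e(P,\omega;\lambda)$ and the invariant $\tilde e(P,\omega;\lambda)$ are defined by $$\tilde e(P,\omega;\lambda)=\sum_{n=0}^\infty\Omega(P,\omega;n)\lambda^n=\frac{e(P,\omega;\lambda)}{(1-\lambda)^{|P|+1}} .$$ For $k\ge1$, $a_k(P,\omega)$ is the number of sequences of ideals $\emptyset=I_0\subseteq I_1\subseteq\dots\subseteq I_k=P$ with every $I_{i+1}\setminus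 I_i$ ($0\le i<k$) $\omega$-natural (directed multi-paths of length $k$ connecting $\emptyset$ and $P$ in the $\omega$-graph), and $c_k(P,\omega)$ is the number of such sequences in which all inclusions are strict (directed paths of length $k$). -}

module Defs where

open import Data.Bool.Properties as Bool using ()
open import Data.Fin.Base as Fin using (Fin; zero; suc; toℕ; fromℕ; inject₁)
open import Data.Fin.Properties as Fin using (all?)
open import Data.Fin.Subset using (Subset; inside; outside; _∈_; _⊆_; _⊂_; _─_; ⊥; ⊤)
open import Data.Fin.Subset.Properties using (_∈?_; _⊆?_; _⊂?_)
open import Data.Integer.Base using (+_)
open import Data.List.Base using (List; []; _∷_; length; filter; allFin; cartesianProductWith)
open import Data.Nat.Base as ℕ using (ℕ; zero; suc; NonZero; _∸_)
open import Data.Nat.Properties as ℕ using ()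
open import Data.Product.Base using (_×_)
open import Data.Rational.Base as ℚ using (ℚ; 0ℚ; 1ℚ)
open import Data.Rational.Properties as ℚ using ()
open import Data.Vec.Base as Vec using (Vec; []; _∷_; lookup)
open import Data.Vec.Properties using (≡-dec)
open import Function.Definitions using (Injective)
open import Level using (0ℓ)
open import Relation.Binary.Core using (Rel)
open import Relation.Binary.Structures using (IsDecPartialOrder)
open import Relation.Binary.PropositionalEquality
  using (_≡_; _≗_; refl; cong; module ≡-Reasoning)
import Relation.Binary.Construct.NonStrictToStrict as ToStrict
open import Relation.Nullary.Decidable using (Dec; _×-dec_; _→-dec_)
open import Relation.Unary using (Pred; Decidable)
open import Algebra.Properties.Monoid.Sum ℚ.+-0-monoid
  using (sum; sum-syntax; sum⁺-syntax)

-- A finite poset is a decidable partial order on Fin size; the labels lie in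
-- ℕ⁺, encoded as the nonzero naturals.
record LabeledPoset : Set₁ where
  infix 4 _≼_
  field
    size              : ℕ
    _≼_               : Rel (Fin size) 0ℓ
    isDecPartialOrder : IsDecPartialOrder _≡_ _≼_
    ω                 : Fin size → ℕ
    ω-nonZero         : ∀ x → NonZero (ω x)
    ω-injective       : Injective _≡_ _≡_ ω

  open IsDecPartialOrder isDecPartialOrder public
    using () renaming (_≟_ to _≟ₚ_; _≤?_ to _≼?_)

  open ToStrict _≡_ _≼_ public using () renaming (_<_ to _≺_)

  _≺?_ : ∀ x y → Dec (x ≺ y)
  _≺?_ = ToStrict.<-decidable _≡_ _≼_ _≟ₚ_ _≼?_

-- All vectors of length n with entries from xs; each vector is listed exactly
-- once when xs has no repetitions.
allVecs : {A : Set} → List A → (n : ℕ) → List (Vec A n)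
allVecs xs zero    = [] ∷ []
allVecs xs (suc n) = cartesianProductWith _∷_ xs (allVecs xs n)

allSubsets : (n : ℕ) → List (Subset n)
allSubsets = allVecs (outside ∷ inside ∷ [])

module _ (P : LabeledPoset) where
  open LabeledPoset P

  -- A map P → [n] is the vector of its values, with [n] encoded as Fin n.
  OmegaOrderPreserving : ∀ {n} → Pred (Vec (Fin n) size) 0ℓ
  OmegaOrderPreserving f =
    (∀ x y → x ≼ y → lookup f x Fin.≤ lookup f y) ×
    (∀ x y → y ≺ x → ω x ℕ.< ω y → lookup f y Fin.< lookup f x)

  omegaOrderPreserving? : ∀ {n} → Decidable (OmegaOrderPreserving {n})
  omegaOrderPreserving? f =
    (all? λ x → all? λ y → (x ≼? y) →-dec (lookup f x Fin.≤? lookup f y))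
    ×-dec
    (all? λ x → all? λ y →
      (y ≺? x) →-dec ((ω x ℕ.<? ω y) →-dec (lookup f y Fin.<? lookup f x)))

  numOmegaOrderPreserving : ℕ → ℕ
  numOmegaOrderPreserving n =
    length (filter omegaOrderPreserving? (allVecs (allFin n) size))

  IsIdeal : Pred (Subset size) 0ℓ
  IsIdeal I = ∀ x y → y ≼ x → x ∈ I → y ∈ I

  isIdeal? : Decidable IsIdeal
  isIdeal? I =
    all? λ x → all? λ y → (y ≼? x) →-dec ((x ∈? I) →-dec (y ∈? I))

  OmegaNatural : Pred (Subset size) 0ℓ
  OmegaNatural S = ∀ x y → x ∈ S → y ∈ S → x ≼ y → ω x ℕ.≤ ω y

  omegaNatural? : Decidable OmegaNatural
  omegaNatural? S =
    all? λ x → all? λ y →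
      (x ∈? S) →-dec ((y ∈? S) →-dec ((x ≼? y) →-dec (ω x ℕ.≤? ω y)))

  -- The sequence I₀ , … , I_k is a vector of length suc k.
  IsMultipath : ∀ {k} → Pred (Vec (Subset size) (suc k)) 0ℓ
  IsMultipath {k} I =
    lookup I zero ≡ ⊥ ×
    lookup I (fromℕ k) ≡ ⊤ ×
    (∀ i → IsIdeal (lookup I i)) ×
    (∀ (i : Fin k) → lookup I (inject₁ i) ⊆ lookup I (suc i)) ×
    (∀ (i : Fin k) → OmegaNatural (lookup I (suc i) ─ lookup I (inject₁ i)))

  isMultipath? : ∀ {k} → Decidable (IsMultipath {k})
  isMultipath? {k} I =
    ≡-dec Bool._≟_ (lookup I zero) ⊥ ×-dec
    ≡-dec Bool._≟_ (lookup I (fromℕ k)) ⊤ ×-dec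
    (all? λ i → isIdeal? (lookup I i)) ×-dec
    (all? λ i → lookup I (inject₁ i) ⊆? lookup I (suc i)) ×-dec
    (all? λ i → omegaNatural? (lookup I (suc i) ─ lookup I (inject₁ i)))

  IsPath : ∀ {k} → Pred (Vec (Subset size) (suc k)) 0ℓ
  IsPath {k} I =
    IsMultipath I ×
    (∀ (i : Fin k) → lookup I (inject₁ i) ⊂ lookup I (suc i))

  isPath? : ∀ {k} → Decidable (IsPath {k})
  isPath? I =
    isMultipath? I ×-dec (all? λ i → lookup I (inject₁ i) ⊂? lookup I (suc i))

  numMultipaths : ℕ → ℕ
  numMultipaths k =
    length (filter isMultipath? (allVecs (allSubsets size) (suc k)))

  numPaths : ℕ → ℕ
  numPaths k = length (filter isPath? (allVecs (allSubsets size) (suc k)))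

ℕ→ℚ : ℕ → ℚ
ℕ→ℚ n = + n ℚ./ 1

-- Coefficients in order of increasing degree.
Polynomial : Set
Polynomial = List ℚ

eval : Polynomial → ℚ → ℚ
eval []      t = 0ℚ
eval (a ∷ p) t = a ℚ.+ t ℚ.* eval p t

-- The polynomial is constrained at the positive integers only; its value at 0
-- is whatever the polynomial extension gives.
IsOrderPolynomial : LabeledPoset → Polynomial → Set
IsOrderPolynomial P Ω =
  ∀ n → .{{_ : NonZero n}} → eval Ω (ℕ→ℚ n) ≡ ℕ→ℚ (numOmegaOrderPreserving P n)

-- Formal power series in the indeterminate X (the λ of the text), given by
-- their coefficients; equality of series is pointwise equality _≗_.
PowerSeries : Set
PowerSeries = ℕ → ℚ

infixl 6 _⊖_
infixl 7 _⊛_ _·_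
infixr 8 _^_

𝟙 : PowerSeries
𝟙 zero    = 1ℚ
𝟙 (suc _) = 0ℚ

X : PowerSeries
X zero          = 0ℚ
X (suc zero)    = 1ℚ
X (suc (suc _)) = 0ℚ

_⊖_ : PowerSeries → PowerSeries → PowerSeries
(f ⊖ g) n = f n ℚ.- g n

_⊛_ : PowerSeries → PowerSeries → PowerSeries
(f ⊛ g) n = ∑[ i ≤ n ] (f (toℕ i) ℚ.* g (n ∸ toℕ i))

_·_ : ℕ → PowerSeries → PowerSeries
(c · f) n = ℕ→ℚ c ℚ.* f n

_^_ : PowerSeries → ℕ → PowerSeries
f ^ zero  = 𝟙
f ^ suc n = f ⊛ f ^ n

-- ∑₁ n F = F 1 + … + F n
∑₁ : ℕ → (ℕ → PowerSeries) → PowerSeries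
∑₁ n F m = ∑[ i < n ] F (suc (toℕ i)) m

-- ∑₁^∞ a = a 1 X + a 2 X² + a 3 X³ + …
∑₁^∞ : (ℕ → ℕ) → PowerSeries
∑₁^∞ a zero    = 0ℚ
∑₁^∞ a (suc k) = ℕ→ℚ (a (suc k))

-- 1 / (1 - X), justified by the lemma below.
1/[1-X] : PowerSeries
1/[1-X] _ = 1ℚ

1/[1-X]-inverse : (𝟙 ⊖ X) ⊛ 1/[1-X] ≗ 𝟙
1/[1-X]-inverse zero          = refl
1/[1-X]-inverse (suc zero)    = refl
1/[1-X]-inverse (suc (suc n)) =
  cong (λ q → 1ℚ ℚ.+ (ℚ.- 1ℚ ℚ.+ q)) (sum-0ℚ (suc n))
  where
  sum-0ℚ : ∀ m → sum {m} (λ _ → 0ℚ) ≡ 0ℚ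
  sum-0ℚ zero    = refl
  sum-0ℚ (suc m) = cong (0ℚ ℚ.+_) (sum-0ℚ m)

-- ẽ as a function of the order polynomial Ω: the sum of Ω(n) Xⁿ over n ≥ 0.
ẽ : Polynomial → PowerSeries
ẽ Ω n = eval Ω (ℕ→ℚ n)

-- The unique solution of ẽ = e / (1 - X)^(|P| + 1); 1 - X is invertible.
eulerian : LabeledPoset → Polynomial → PowerSeries
eulerian P Ω = (𝟙 ⊖ X) ^ suc (LabeledPoset.size P) ⊛ ẽ Ω

module Submission where

-- A map P → [n] is the same as the chain I₀ ⊆ … ⊆ Iₙ of its level sets
-- Iᵢ = { x | f x < i } (values in {0, …, n - 1}), and f is ω-order-preserving
-- iff this chain is a directed multi-path; so Ω(n) = aₙ for n ≥ 1.  A multi-path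
-- is a walk in a digraph with a loop at every vertex, so expanding the power
-- (1 + A)ⁿ of its adjacency matrix, with A the loopless part, gives
-- aₙ = ∑ₖ (n C k) cₖ.  Here (n C k) is the coefficient of Xⁿ in
-- (1 / (1 - X)) (X / (1 - X))ᵏ.  At n = 0, Ω(0) = 0 = a₀ since both sides of
-- Ω(n) = ∑ₖ (n C k) cₖ are annihilated by an iterated difference operator, and
-- such a sequence is determined at 0 by its values at the positive integers.

open import Defs
open import Algebra.Bundles using (CommutativeMonoid; CommutativeRing)
import Algebra.Properties.CommutativeSemigroup as CommutativeSemigroupProperties
import Algebra.Properties.Group as GroupProperties
import Algebra.Properties.Semiring.Sum as SemiringSum
open import Data.Bool.Base using (true; false)
import Data.Bool.Properties as Bool
open import Data.Fin.Base as Fin using (Fin; zero; suc; toℕ; fromℕ; inject₁; inject)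
open import Data.Fin.Properties as Fin using (toℕ<n; toℕ-injective; toℕ-inject₁; toℕ-fromℕ; ¬∀⟶∃¬-smallest)
open import Data.Fin.Subset using (Subset; inside; outside; _∈_; _∉_; _⊆_; _⊂_; _─_; ⊥; ⊤; ∣_∣)
open import Data.Fin.Subset.Properties
  using (_∈?_; _⊆?_; _⊂?_; ⊆-antisym; ∉⊥; ⊥⊆; ∈⊤; ⊆⊤; p⊂q⇒∣p∣<∣q∣; ∣p∣≤n; ⊂-irref; p─q⊆p; x∈p∧x∉q⇒x∈p─q)
import Data.Integer.Base as ℤ
import Data.Integer.Properties as ℤ
open import Data.List.Base using (List; []; _∷_; _++_; length; map; filter; allFin; cartesianProductWith)
import Data.List.Membership.Propositional as List
open import Data.List.Membership.Propositional.Properties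
  using (∈-cartesianProductWith⁺; ∈-filter⁺; ∈-filter⁻; ∈-allFin; ∈-map⁺; ∈-map⁻)
open import Data.List.Membership.Propositional.Properties.WithK using (unique∧set⇒bag)
open import Data.List.Properties using (length-map; length-++; map-cong; filter-++; filter-≐; filter-none)
open import Data.List.Relation.Binary.BagAndSetEquality using (∼bag⇒↭)
open import Data.List.Relation.Binary.Permutation.Propositional using (_↭_)
open import Data.List.Relation.Binary.Permutation.Propositional.Properties using (↭-length; map⁺)
open import Data.List.Relation.Unary.All as All using ([]; _∷_)
open import Data.List.Relation.Unary.AllPairs using ([]; _∷_)
open import Data.List.Relation.Unary.Any using (here; there)
open import Data.List.Relation.Unary.Unique.Propositional using (Unique)
import Data.List.Relation.Unary.Unique.Propositional.Properties as Unique
open import Data.Nat.Base as ℕ using (ℕ; zero; suc; NonZero; _∸_; _≤_; _<_; z≤n; s≤s)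
open import Data.Nat.Combinatorics using (_C_; nCk+nC[k+1]≡[n+1]C[k+1]; nCk≡nC[n∸k]; nCn≡1; k>n⇒nCk≡0)
open import Data.Nat.ListAction using () renaming (sum to ∑ˡ)
open import Data.Nat.ListAction.Properties using (sum-↭)
import Data.Nat.Properties as ℕ
open import Data.Product.Base using (∃; _×_; _,_; proj₁; proj₂)
open import Data.Rational.Base as ℚ using (ℚ; 0ℚ; 1ℚ; toℚᵘ)
import Data.Rational.Properties as ℚ
open import Data.Rational.Unnormalised.Base as ℚᵘ using (mkℚᵘ; *≡*)
import Data.Rational.Unnormalised.Properties as ℚᵘ
open import Data.Sum.Base using (_⊎_; inj₁; inj₂)
open import Data.Vec.Base as Vec using (Vec; []; _∷_; lookup; tabulate)
open import Data.Vec.Properties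
  using (≡-dec; ∷-injective; lookup⇒[]=; []=⇒lookup; lookup∘tabulate; tabulate∘lookup; tabulate-cong)
open import Function.Base using (_∘_; id)
open import Function.Bundles using (_⇔_; mk⇔; Equivalence)
open import Level using (0ℓ)
open import Relation.Binary.Bundles using (Setoid)
open import Relation.Binary.Core using (Rel)
import Relation.Binary.Definitions as Binary
open import Relation.Binary.PropositionalEquality
  using (_≡_; _≢_; _≗_; refl; sym; trans; cong; cong₂; subst; module ≡-Reasoning; _→-setoid_)
open import Relation.Nullary.Decidable using (Dec; yes; no; does; dec-true; decidable-stable; _×-dec_; _→-dec_)
open import Relation.Nullary.Negation using (¬_; contradiction)
open import Relation.Unary using (Pred; Decidable)

open Equivalence using (to; from)

nC0≡1 : ∀ n → n C 0 ≡ 1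
nC0≡1 n = trans (nCk≡nC[n∸k] {n = n} z≤n) (nCn≡1 n)

-- Chains of subsets as walks in a digraph.

module Multipaths where

  open import Data.Nat.Base using (_+_; _*_)

  -- Counting in enumerations

  private
    variable
      A B : Set

  IsEnumeration : List A → Set
  IsEnumeration xs = Unique xs × (∀ x → x List.∈ xs)

  allVecs-isEnumeration : ∀ {xs : List A} → IsEnumeration xs → ∀ n → IsEnumeration (allVecs xs n)
  allVecs-isEnumeration enum zero    = ([] ∷ []) , λ { [] → here refl }
  allVecs-isEnumeration enum@(uniq , complete) (suc n) with allVecs-isEnumeration enum n
  ... | uniqₙ , completeₙ =
    Unique.cartesianProductWith⁺ _∷_ ∷-injective uniq uniqₙ ,
    λ { (x ∷ v) → ∈-cartesianProductWith⁺ _∷_ (complete x) (completeₙ v) }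

  allSubsets-isEnumeration : ∀ n → IsEnumeration (allSubsets n)
  allSubsets-isEnumeration = allVecs-isEnumeration
    ((((λ ()) ∷ []) ∷ ([] ∷ [])) , λ { outside → here refl ; inside → there (here refl) })

  allFin-isEnumeration : ∀ n → IsEnumeration (allFin n)
  allFin-isEnumeration n = Unique.allFin⁺ n , ∈-allFin

  unique∧set⇒↭ : ∀ {xs ys : List A} → Unique xs → Unique ys →
                 (∀ {x} → x List.∈ xs ⇔ x List.∈ ys) → xs ↭ ys
  unique∧set⇒↭ uniqˣ uniqʸ xs∼ys = ∼bag⇒↭ (unique∧set⇒bag uniqˣ uniqʸ xs∼ys)

  module _ {P : Pred A 0ℓ} (P? : Decidable P) where

    count : List A → ℕ
    count xs = length (filter P? xs)

    count-none : (∀ x → ¬ P x) → ∀ xs → count xs ≡ 0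
    count-none ¬P xs = cong length (filter-none P? (All.universal ¬P xs))

    count-++ : ∀ xs ys → count (xs ++ ys) ≡ count xs + count ys
    count-++ xs ys = trans (cong length (filter-++ P? xs ys)) (length-++ (filter P? xs))

    count-map : ∀ (f : B → A) xs → count (map f xs) ≡ length (filter (P? ∘ f) xs)
    count-map f []       = refl
    count-map f (x ∷ xs) with does (P? (f x))
    ... | true  = cong suc (count-map f xs)
    ... | false = count-map f xs

  count-cong : ∀ {P Q : Pred A 0ℓ} (P? : Decidable P) (Q? : Decidable Q) →
               (∀ x → P x ⇔ Q x) → count P? ≗ count Q?
  count-cong P? Q? P⇔Q xs =
    cong length (filter-≐ P? Q? ((λ {x} → to (P⇔Q x)) , (λ {x} → from (P⇔Q x))) xs)

  count-bijection : ∀ {P : Pred A 0ℓ} {Q : Pred B 0ℓ} (P? : Decidable P) (Q? : Decidable Q)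
                    {xs ys} → IsEnumeration xs → IsEnumeration ys →
                    (f : A → B) → (∀ {x y} → f x ≡ f y → x ≡ y) → (∀ x → P x → Q (f x)) →
                    (∀ y → Q y → ∃ λ x → P x × y ≡ f x) → count P? xs ≡ count Q? ys
  count-bijection {P = P} {Q} P? Q? {xs} {ys} (uniqˣ , completeˣ) (uniqʸ , completeʸ) f f-inj P⇒Q Q⇒P = begin
    length (filter P? xs)           ≡⟨ length-map f (filter P? xs) ⟨
    length (map f (filter P? xs))   ≡⟨ ↭-length (unique∧set⇒↭ (Unique.map⁺ f-inj (Unique.filter⁺ P? uniqˣ))
                                                              (Unique.filter⁺ Q? uniqʸ) (mk⇔ to′ from′)) ⟩
    length (filter Q? ys)           ∎
    where
    open ≡-Reasoning
    to′ : ∀ {y} → y List.∈ map f (filter P? xs) → y List.∈ filter Q? ys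
    to′ y∈ with ∈-map⁻ f y∈
    ... | x , x∈ , refl = ∈-filter⁺ Q? (completeʸ (f x)) (P⇒Q x (proj₂ (∈-filter⁻ P? {xs = xs} x∈)))
    from′ : ∀ {y} → y List.∈ filter Q? ys → y List.∈ map f (filter P? xs)
    from′ {y} y∈ with Q⇒P y (proj₂ (∈-filter⁻ Q? {xs = ys} y∈))
    ... | x , px , refl = ∈-map⁺ f (∈-filter⁺ P? (completeˣ x) px)

  -- Counts vectors by their head: a head outside `F` contributes 0, any other contributes the
  -- number of admissible tails. This yields both the first-step recursion for walks and the removal
  -- of the fixed first set of a multi-path.
  count-∷ : ∀ {n} {P : Pred (Vec A (suc n)) 0ℓ} {F : Pred A 0ℓ} {G : A → Pred (Vec A n) 0ℓ}
            (P? : Decidable P) (F? : Decidable F) (G? : ∀ x → Decidable (G x)) →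
            (∀ x v → P (x ∷ v) ⇔ (F x × G x v)) → ∀ xs vs →
            count P? (cartesianProductWith _∷_ xs vs) ≡
            ∑ˡ (map (λ x → count (G? x) vs) (filter F? xs))
  count-∷ P? F? G? P⇔ []       vs = refl
  count-∷ P? F? G? P⇔ (x ∷ xs) vs = trans
    (trans (count-++ P? (map (x ∷_) vs) _)
           (cong₂ _+_ (count-map P? (x ∷_) vs) (count-∷ P? F? G? P⇔ xs vs)))
    head-case
    where
    rest = λ L → ∑ˡ (map (λ y → count (G? y) vs) L)
    head-case : count (P? ∘ (x ∷_)) vs + rest (filter F? xs) ≡ rest (filter F? (x ∷ xs))
    head-case with F? x
    ... | yes fx = cong (_+ rest (filter F? xs))
      (count-cong (P? ∘ (x ∷_)) (G? x) (λ v → mk⇔ (proj₂ ∘ to (P⇔ x v)) (λ g → from (P⇔ x v) (fx , g))) vs)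
    ... | no ¬fx = cong (_+ rest (filter F? xs))
      (count-none (P? ∘ (x ∷_)) (λ v → ¬fx ∘ proj₁ ∘ to (P⇔ x v)) vs)

  -- Walks in a digraph

  module Walks {A : Set} {E : Rel A 0ℓ} (E? : Binary.Decidable E)
               (t : A) (≡t? : ∀ x → Dec (x ≡ t)) (xs : List A) where

    -- The start vertex stays outside the vector, so that the length of the vector is the number of
    -- edges.
    Walk : ∀ {k} → A → Vec A k → Set
    Walk x []      = x ≡ t
    Walk x (y ∷ v) = E x y × Walk y v

    walk? : ∀ {k} x → Decidable (Walk {k} x)
    walk? x []      = ≡t? x
    walk? x (y ∷ v) = E? x y ×-dec walk? y v

    walks : ℕ → A → ℕ
    walks k x = count (walk? x) (allVecs xs k)

    walks-suc : ∀ k x → walks (suc k) x ≡ ∑ˡ (map (walks k) (filter (E? x) xs))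
    walks-suc k x = count-∷ (walk? x) (E? x) walk? (λ _ _ → mk⇔ id id) xs (allVecs xs k)

    walks-zero : ∀ {x} → x ≢ t → walks 0 x ≡ 0
    walks-zero {x} x≢t = count-none (walk? x) (λ { [] → x≢t }) (allVecs xs 0)

    -- Links the recursive form, suited to counting by the first step, with the indexed form in
    -- which `IsMultipath` and `IsPath` are phrased.
    walk⇔ : ∀ {k} x (v : Vec A k) → Walk x v ⇔
            (lookup (x ∷ v) (fromℕ k) ≡ t ×
             ∀ i → E (lookup (x ∷ v) (inject₁ i)) (lookup (x ∷ v) (suc i)))
    walk⇔ x []      = mk⇔ (λ x≡t → x≡t , λ ()) proj₁
    walk⇔ x (y ∷ v) = mk⇔
      (λ (e , w) → let last≡t , edges = to (walk⇔ y v) w in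
        last≡t , λ { zero → e ; (suc i) → edges i })
      (λ (last≡t , edges) → edges zero , from (walk⇔ y v) (last≡t , edges ∘ suc))

    module _ (rank : A → ℕ) (rank-mono : ∀ {x y} → E x y → rank x < rank y) where

      -- Every edge raises the rank by at least 1. This bounds the length of a walk and makes the
      -- binomial expansion below finite.
      walk-rank : ∀ {k} x (v : Vec A k) → Walk x v → rank x + k ≤ rank t
      walk-rank x []                  refl    = ℕ.≤-reflexive (ℕ.+-identityʳ (rank x))
      walk-rank {suc k} x (y ∷ v) (e , w) = begin
        rank x + suc k     ≡⟨ ℕ.+-suc (rank x) k ⟩
        suc (rank x) + k   ≤⟨ ℕ.+-monoˡ-≤ k (rank-mono e) ⟩
        rank y + k         ≤⟨ walk-rank y v w ⟩
        rank t             ∎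
        where open ℕ.≤-Reasoning

      walks-long : ∀ {k} → rank t < k → ∀ x → walks k x ≡ 0
      walks-long {k} t<k x = count-none (walk? x)
        (λ v w → ℕ.<⇒≱ t<k (ℕ.≤-trans (ℕ.m≤n+m k (rank x)) (walk-rank x v w))) (allVecs xs k)

  -- (1 + E⁺)ⁿ = ∑ₖ (n C k) (E⁺)ᵏ for the adjacency matrix of E⁺.
  module WalksBinomial
    {A : Set} {E E⁺ : Rel A 0ℓ} (E? : Binary.Decidable E) (E⁺? : Binary.Decidable E⁺)
    (E⇔ : ∀ x y → E x y ⇔ (x ≡ y ⊎ E⁺ x y)) (E⁺-irrefl : ∀ x → ¬ E⁺ x x)
    (t : A) (≡t? : ∀ x → Dec (x ≡ t)) {xs : List A} (enum : IsEnumeration xs) where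

    open SemiringSum ℕ.+-*-semiring using (sum-syntax; sum⁺-syntax; sum-cong-≗; ∑-distrib-+; sum-replicate-zero)
    open Walks E? t ≡t? xs
    open Walks E⁺? t ≡t? xs renaming (walk? to walk⁺?; walks to walks⁺; walks-suc to walks⁺-suc) using ()

    -- The decomposition `1 + A` of the adjacency matrix, read off one row. Irreflexivity of `E⁺`
    -- ensures that `x` is not listed twice.
    filter-E : ∀ x → filter (E? x) xs ↭ x ∷ filter (E⁺? x) xs
    filter-E x = unique∧set⇒↭ (Unique.filter⁺ (E? x) uniq)
      (All.tabulate x∉ ∷ Unique.filter⁺ (E⁺? x) uniq) (mk⇔ to′ from′)
      where
      uniq     = proj₁ enum
      complete = proj₂ enum
      x∉ : ∀ {y} → y List.∈ filter (E⁺? x) xs → x ≢ y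
      x∉ y∈ refl = E⁺-irrefl x (proj₂ (∈-filter⁻ (E⁺? x) {xs = xs} y∈))
      to′ : ∀ {y} → y List.∈ filter (E? x) xs → y List.∈ x ∷ filter (E⁺? x) xs
      to′ {y} y∈ with to (E⇔ x y) (proj₂ (∈-filter⁻ (E? x) {xs = xs} y∈))
      ... | inj₁ refl = here refl
      ... | inj₂ e    = there (∈-filter⁺ (E⁺? x) (complete y) e)
      from′ : ∀ {y} → y List.∈ x ∷ filter (E⁺? x) xs → y List.∈ filter (E? x) xs
      from′ {y} (here refl) = ∈-filter⁺ (E? x) (complete y) (from (E⇔ x y) (inj₁ refl))
      from′ {y} (there y∈)  = ∈-filter⁺ (E? x) (complete y)
        (from (E⇔ x y) (inj₂ (proj₂ (∈-filter⁻ (E⁺? x) {xs = xs} y∈))))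

    ∑ˡ-∑ : ∀ m (c : ℕ → ℕ) (g : ℕ → A → ℕ) L →
           ∑ˡ (map (λ y → ∑[ k < m ] (c (toℕ k) * g (toℕ k) y)) L) ≡
           ∑[ k < m ] (c (toℕ k) * ∑ˡ (map (g (toℕ k)) L))
    ∑ˡ-∑ m c g []      = sym (trans (sum-cong-≗ {m} (λ k → ℕ.*-zeroʳ (c (toℕ k)))) (sum-replicate-zero m))
    ∑ˡ-∑ m c g (y ∷ L) = begin
      ∑[ k < m ] (c (toℕ k) * g (toℕ k) y) + ∑ˡ (map (λ y → ∑[ k < m ] (c (toℕ k) * g (toℕ k) y)) L)
        ≡⟨ cong (∑[ k < m ] (c (toℕ k) * g (toℕ k) y) +_) (∑ˡ-∑ m c g L) ⟩
      ∑[ k < m ] (c (toℕ k) * g (toℕ k) y) + ∑[ k < m ] (c (toℕ k) * ∑ˡ (map (g (toℕ k)) L))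
        ≡⟨ ∑-distrib-+ {m} (λ k → c (toℕ k) * g (toℕ k) y) (λ k → c (toℕ k) * ∑ˡ (map (g (toℕ k)) L)) ⟨
      ∑[ k < m ] (c (toℕ k) * g (toℕ k) y + c (toℕ k) * ∑ˡ (map (g (toℕ k)) L))
        ≡⟨ sum-cong-≗ {m} (λ k → ℕ.*-distribˡ-+ (c (toℕ k)) (g (toℕ k) y) (∑ˡ (map (g (toℕ k)) L))) ⟨
      ∑[ k < m ] (c (toℕ k) * ∑ˡ (map (g (toℕ k)) (y ∷ L)))
        ∎
      where open ≡-Reasoning

    ∑-last : ∀ m (a : ℕ → ℕ) → ∑[ k ≤ m ] a (toℕ k) ≡ ∑[ k < m ] a (toℕ k) + a m
    ∑-last zero    a = ℕ.+-comm (a 0) 0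
    ∑-last (suc m) a = trans (cong (a 0 +_) (∑-last m (a ∘ suc))) (sym (ℕ.+-assoc (a 0) _ _))

    -- Induction on `n`: the first step either stays at `x` or follows an `E⁺`-edge, and Pascal's
    -- rule merges the two resulting sums. The hypothesis on `walks⁺ (suc m)` keeps the range
    -- `k ≤ m` stable under the shift of index caused by the second kind of step.
    walks-binomial : ∀ m → (∀ x → walks⁺ (suc m) x ≡ 0) → ∀ n x →
                     walks n x ≡ ∑[ k ≤ m ] ((n C toℕ k) * walks⁺ (toℕ k) x)
    walks-binomial m long zero x = sym (begin
      1 * walks⁺ 0 x + ∑[ k < m ] ((0 C suc (toℕ k)) * walks⁺ (suc (toℕ k)) x)
        ≡⟨ cong₂ _+_ (ℕ.*-identityˡ (walks⁺ 0 x))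
             (trans (sum-cong-≗ {m} (λ k → cong (_* walks⁺ (suc (toℕ k)) x) (k>n⇒nCk≡0 {0} {suc (toℕ k)} (s≤s z≤n))))
                    (sum-replicate-zero m)) ⟩
      walks⁺ 0 x + 0
        ≡⟨ ℕ.+-identityʳ (walks⁺ 0 x) ⟩
      walks⁺ 0 x
        ≡⟨ count-cong (walk⁺? x) (walk? x) (λ { [] → mk⇔ id id }) (allVecs xs 0) ⟩
      walks 0 x
        ∎)
      where open ≡-Reasoning
    walks-binomial m long (suc n) x = begin
      walks (suc n) x
        ≡⟨ walks-suc n x ⟩
      ∑ˡ (map (walks n) (filter (E? x) xs))
        ≡⟨ sum-↭ (map⁺ (walks n) (filter-E x)) ⟩
      walks n x + ∑ˡ (map (walks n) L)
        ≡⟨ cong₂ _+_ (walks-binomial m long n x)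
             (trans (cong ∑ˡ (map-cong (walks-binomial m long n) L)) (∑ˡ-∑ (suc m) (n C_) walks⁺ L)) ⟩
      ((n C 0) * walks⁺ 0 x + ∑[ k < m ] ((n C suc (toℕ k)) * walks⁺ (suc (toℕ k)) x)) +
      ∑[ k ≤ m ] ((n C toℕ k) * ∑ˡ (map (walks⁺ (toℕ k)) L))
        -- The term `k = 0` has no partner in the shifted sum; its coefficients for `n` and `suc n`
        -- are both 1.
        ≡⟨ cong₂ _+_ (cong (λ c → c * walks⁺ 0 x + S₁) (trans (nC0≡1 n) (sym (nC0≡1 (suc n)))))
             (trans (sum-cong-≗ {suc m} (λ k → cong ((n C toℕ k) *_) (sym (walks⁺-suc (toℕ k) x))))
                    (∑-last m (λ k → (n C k) * walks⁺ (suc k) x))) ⟩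
      ((suc n C 0) * walks⁺ 0 x + ∑[ k < m ] ((n C suc (toℕ k)) * walks⁺ (suc (toℕ k)) x)) +
      (∑[ k < m ] ((n C toℕ k) * walks⁺ (suc (toℕ k)) x) + (n C m) * walks⁺ (suc m) x)
        -- The shifted sum overflows by one term, of length `suc m`, which vanishes by `long`.
        ≡⟨ cong (λ z → (suc n C 0) * walks⁺ 0 x + S₁ + (S₀ + z)) (trans (cong ((n C m) *_) (long x)) (ℕ.*-zeroʳ (n C m))) ⟩
      ((suc n C 0) * walks⁺ 0 x + S₁) + (S₀ + 0)
        ≡⟨ trans (ℕ.+-assoc ((suc n C 0) * walks⁺ 0 x) S₁ (S₀ + 0))
                 (cong ((suc n C 0) * walks⁺ 0 x +_) (trans (cong (S₁ +_) (ℕ.+-identityʳ S₀)) (ℕ.+-comm S₁ S₀))) ⟩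
      (suc n C 0) * walks⁺ 0 x + (S₀ + S₁)
        ≡⟨ cong ((suc n C 0) * walks⁺ 0 x +_) (trans
             (sym (∑-distrib-+ {m} (λ k → (n C toℕ k) * walks⁺ (suc (toℕ k)) x) (λ k → (n C suc (toℕ k)) * walks⁺ (suc (toℕ k)) x)))
             (sum-cong-≗ {m} (λ k → trans (sym (ℕ.*-distribʳ-+ (walks⁺ (suc (toℕ k)) x) (n C toℕ k) (n C suc (toℕ k))))
               (cong (_* walks⁺ (suc (toℕ k)) x) (nCk+nC[k+1]≡[n+1]C[k+1] n (toℕ k)))))) ⟩
      ∑[ k ≤ m ] ((suc n C toℕ k) * walks⁺ (toℕ k) x)
        ∎
      where
      open ≡-Reasoning
      L  = filter (E⁺? x) xs
      S₀ = ∑[ k < m ] ((n C toℕ k) * walks⁺ (suc (toℕ k)) x)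
      S₁ = ∑[ k < m ] ((n C suc (toℕ k)) * walks⁺ (suc (toℕ k)) x)

  -- Subsets as Boolean vectors.

  x∈p─q⇒x∉q : ∀ {n} (p q : Subset n) {x} → x ∈ p ─ q → x ∉ q
  x∈p─q⇒x∉q (_ ∷ p) (outside ∷ q) {suc x} (Vec.there x∈p─q) (Vec.there x∈q) = x∈p─q⇒x∉q p q x∈p─q x∈q
  x∈p─q⇒x∉q (_ ∷ p) (inside  ∷ q) {suc x} (Vec.there x∈p─q) (Vec.there x∈q) = x∈p─q⇒x∉q p q x∈p─q x∈q

  x∈tabulate⇔ : ∀ {n} {P : Pred (Fin n) 0ℓ} (P? : Decidable P) x →
                x ∈ tabulate (does ∘ P?) ⇔ P x
  x∈tabulate⇔ P? x = mk⇔
    (λ x∈ → does⇒ (P? x) (trans (sym (lookup∘tabulate (does ∘ P?) x)) ([]=⇒lookup x∈)))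
    (λ px → lookup⇒[]= x _ (trans (lookup∘tabulate (does ∘ P?) x) (dec-true (P? x) px)))
    where
    does⇒ : ∀ {Q : Set} (Q? : Dec Q) → does Q? ≡ true → Q
    does⇒ (yes q) _ = q

  lookup-injective : ∀ {A : Set} {n} {v w : Vec A n} → lookup v ≗ lookup w → v ≡ w
  lookup-injective {v = v} {w} v≗w =
    trans (sym (tabulate∘lookup v)) (trans (tabulate-cong v≗w) (tabulate∘lookup w))

  -- The ω-graph of a labeled poset and its level-set chains.

  module _ (P : LabeledPoset) where
    open LabeledPoset P

    Edge Edge⁺ : Rel (Subset size) 0ℓ
    -- Phrasing ideality as an implication makes Edge reflexive on all subsets;
    -- since P is an ideal, all vertices of a walk ending at P are still ideals.
    Edge I J  = (IsIdeal P J → IsIdeal P I) × I ⊆ J × OmegaNatural P (J ─ I)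
    Edge⁺ I J = Edge I J × I ⊂ J

    edge? : Binary.Decidable Edge
    edge? I J = (isIdeal? P J →-dec isIdeal? P I) ×-dec (I ⊆? J) ×-dec omegaNatural? P (J ─ I)

    edge⁺? : Binary.Decidable Edge⁺
    edge⁺? I J = edge? I J ×-dec (I ⊂? J)

    ⊆⇒≡⊎⊂ : ∀ {I J : Subset size} → I ⊆ J → I ≡ J ⊎ I ⊂ J
    ⊆⇒≡⊎⊂ {I} {J} I⊆J with I ⊂? J
    ... | yes I⊂J = inj₂ I⊂J
    ... | no  I⊄J = inj₁ (⊆-antisym I⊆J
      (λ {x} x∈J → decidable-stable (x ∈? I) (λ x∉I → I⊄J (I⊆J , x , x∈J , x∉I))))

    -- Loops are edges because `I ─ I` is empty, hence ω-natural; any other inclusion is strict.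
    edge⇔ : ∀ I J → Edge I J ⇔ (I ≡ J ⊎ Edge⁺ I J)
    edge⇔ I J = mk⇔ to′ from′
      where
      to′ : Edge I J → I ≡ J ⊎ Edge⁺ I J
      to′ e@(_ , I⊆J , _) with ⊆⇒≡⊎⊂ {I} {J} I⊆J
      ... | inj₁ I≡J = inj₁ I≡J
      ... | inj₂ I⊂J = inj₂ (e , I⊂J)
      from′ : I ≡ J ⊎ Edge⁺ I J → Edge I J
      from′ (inj₁ refl)    = id , id , λ _ _ x∈ _ _ → contradiction (p─q⊆p I I x∈) (x∈p─q⇒x∉q I I x∈)
      from′ (inj₂ (e , _)) = e

    ≡⊤? : ∀ (I : Subset size) → Dec (I ≡ ⊤)
    ≡⊤? I = ≡-dec Bool._≟_ I ⊤

    ≡⊥? : ∀ (I : Subset size) → Dec (I ≡ ⊥)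
    ≡⊥? I = ≡-dec Bool._≟_ I ⊥

    open Walks edge? ⊤ ≡⊤? (allSubsets size)
    open Walks edge⁺? ⊤ ≡⊤? (allSubsets size)
      renaming (Walk to Walk⁺; walk? to walk⁺?; walks to walks⁺; walk⇔ to walk⁺⇔;
                walks-long to walks⁺-long; walks-zero to walks⁺-zero)
      using ()
    open WalksBinomial edge? edge⁺? edge⇔ (λ _ → ⊂-irref refl ∘ proj₂) ⊤ ≡⊤? (allSubsets-isEnumeration size)
      using (walks-binomial)

    walk-isIdeal : ∀ {k} I (v : Vec (Subset size) k) → Walk I v → ∀ i → IsIdeal P (lookup (I ∷ v) i)
    walk-isIdeal I []      refl    zero    = λ _ _ _ _ → ∈⊤
    walk-isIdeal I (J ∷ v) (e , w) zero    = proj₁ e (walk-isIdeal J v w zero)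
    walk-isIdeal I (J ∷ v) (e , w) (suc i) = walk-isIdeal J v w i

    -- Separates the condition on the first set from the rest, in the shape that `count-∷` expects.
    -- Summing over the admissible heads then leaves the single term at `⊥`.
    isMultipath⇔ : ∀ {k} I (v : Vec (Subset size) k) → IsMultipath P (I ∷ v) ⇔ (I ≡ ⊥ × Walk I v)
    isMultipath⇔ I v = mk⇔
      (λ (I≡⊥ , last≡⊤ , ideals , increasing , natural) →
        I≡⊥ , from (walk⇔ I v) (last≡⊤ , λ i → (λ _ → ideals (inject₁ i)) , increasing i , natural i))
      (λ (I≡⊥ , w) → let last≡⊤ , edges = to (walk⇔ I v) w in
        I≡⊥ , last≡⊤ , walk-isIdeal I v w ,
        (λ i → proj₁ (proj₂ (edges i))) , (λ i → proj₂ (proj₂ (edges i))))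

    isPath⇔ : ∀ {k} I (v : Vec (Subset size) k) → IsPath P (I ∷ v) ⇔ (I ≡ ⊥ × Walk⁺ I v)
    isPath⇔ I v = mk⇔
      (λ (mp , strict) → let I≡⊥ , w = to (isMultipath⇔ I v) mp
                             last≡⊤ , edges = to (walk⇔ I v) w in
        I≡⊥ , from (walk⁺⇔ I v) (last≡⊤ , λ i → edges i , strict i))
      (λ (I≡⊥ , w⁺) → let last≡⊤ , edges = to (walk⁺⇔ I v) w⁺ in
        from (isMultipath⇔ I v) (I≡⊥ , from (walk⇔ I v) (last≡⊤ , proj₁ ∘ edges)) , proj₂ ∘ edges)

    filter-≡⊥ : filter ≡⊥? (allSubsets size) ↭ ⊥ ∷ []
    filter-≡⊥ with allSubsets-isEnumeration size
    ... | uniq , complete = unique∧set⇒↭ (Unique.filter⁺ ≡⊥? uniq) ([] ∷ [])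
      (mk⇔ (λ I∈ → here (proj₂ (∈-filter⁻ ≡⊥? {xs = allSubsets size} I∈)))
           (λ { (here refl) → ∈-filter⁺ ≡⊥? (complete ⊥) refl }))

    ∑ˡ-filter-≡⊥ : ∀ (g : Subset size → ℕ) → ∑ˡ (map g (filter ≡⊥? (allSubsets size))) ≡ g ⊥
    ∑ˡ-filter-≡⊥ g = trans (sum-↭ (map⁺ g filter-≡⊥)) (ℕ.+-identityʳ (g ⊥))

    numMultipaths≡walks : ∀ k → numMultipaths P k ≡ walks k ⊥
    numMultipaths≡walks k =
      trans (count-∷ (isMultipath? P) ≡⊥? walk? isMultipath⇔ (allSubsets size) _) (∑ˡ-filter-≡⊥ (walks k))

    numPaths≡walks⁺ : ∀ k → numPaths P k ≡ walks⁺ k ⊥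
    numPaths≡walks⁺ k =
      trans (count-∷ (isPath? P) ≡⊥? walk⁺? isPath⇔ (allSubsets size) _) (∑ˡ-filter-≡⊥ (walks⁺ k))

    -- Cardinality serves as rank: it grows along strict inclusions and is at most `size`.
    walks⁺-size : ∀ I → walks⁺ (suc size) I ≡ 0
    walks⁺-size = walks⁺-long ∣_∣ (λ e → p⊂q⇒∣p∣<∣q∣ (proj₂ e)) (s≤s (∣p∣≤n {size} ⊤))

    -- Here non-emptiness of the poset enters. For `size` 0 the walk of length 0 would already join
    -- `⊥` to `⊤` and add a term with `k = 0`.
    ⊥≢⊤ : .{{NonZero size}} → ⊥ {size} ≢ ⊤
    ⊥≢⊤ = nonEmpty size
      where
      nonEmpty : ∀ n → .{{NonZero n}} → ⊥ {n} ≢ ⊤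
      nonEmpty (suc n) ()

    numMultipaths-zero : .{{NonZero size}} → numMultipaths P 0 ≡ 0
    numMultipaths-zero = trans (numMultipaths≡walks 0) (walks-zero ⊥≢⊤)

    open SemiringSum ℕ.+-*-semiring using (sum-syntax; sum-cong-≗)

    numMultipaths-binomial : .{{NonZero size}} → ∀ n →
      numMultipaths P n ≡ ∑[ k < size ] ((n C suc (toℕ k)) * numPaths P (suc (toℕ k)))
    numMultipaths-binomial n = begin
      numMultipaths P n
        ≡⟨ numMultipaths≡walks n ⟩
      walks n ⊥
        ≡⟨ walks-binomial size walks⁺-size n ⊥ ⟩
      (n C 0) * walks⁺ 0 ⊥ + ∑[ k < size ] ((n C suc (toℕ k)) * walks⁺ (suc (toℕ k)) ⊥)
        -- The term `k = 0` drops out, since no walk of length 0 joins the distinct vertices `⊥` and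
        -- `⊤`.
        ≡⟨ cong₂ _+_ (trans (cong ((n C 0) *_) (walks⁺-zero ⊥≢⊤)) (ℕ.*-zeroʳ (n C 0)))
             (sum-cong-≗ {size} (λ k → cong ((n C suc (toℕ k)) *_) (sym (numPaths≡walks⁺ (suc (toℕ k)))))) ⟩
      ∑[ k < size ] ((n C suc (toℕ k)) * numPaths P (suc (toℕ k)))
        ∎
      where open ≡-Reasoning

    -- The bijection between maps P → [n] and their level sets

    -- A relation rather than a function, so that the same lemmas apply to `levelSets f` and to a
    -- multi-path given in advance.
    IsLevelSets : ∀ {n} → Vec (Fin n) size → Vec (Subset size) (suc n) → Set
    IsLevelSets f I = ∀ i x → x ∈ lookup I i ⇔ toℕ (lookup f x) < toℕ i

    levelSets : ∀ {n} → Vec (Fin n) size → Vec (Subset size) (suc n)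
    levelSets f = tabulate λ i → tabulate λ x → does (toℕ (lookup f x) ℕ.<? toℕ i)

    levelSets-isLevelSets : ∀ {n} (f : Vec (Fin n) size) → IsLevelSets f (levelSets f)
    levelSets-isLevelSets f i x =
      subst (λ S → x ∈ S ⇔ toℕ (lookup f x) < toℕ i) (sym (lookup∘tabulate (λ i → tabulate λ x → does (toℕ (lookup f x) ℕ.<? toℕ i)) i))
        (x∈tabulate⇔ (λ x → toℕ (lookup f x) ℕ.<? toℕ i) x)

    isLevelSets-unique : ∀ {n} (f : Vec (Fin n) size) {I J} →
                         IsLevelSets f I → IsLevelSets f J → I ≡ J
    isLevelSets-unique f LI LJ = lookup-injective λ i →
      ⊆-antisym (λ {x} → from (LJ i x) ∘ to (LI i x)) (λ {x} → from (LI i x) ∘ to (LJ i x))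

    -- The element `x` lies in the level set of index `suc (lookup f x)`. Carrying this membership
    -- over to `g` bounds `lookup g x` by `lookup f x`; the other inequality is symmetric.
    levelSets-injective : ∀ {n} {f g : Vec (Fin n) size} → levelSets f ≡ levelSets g → f ≡ g
    levelSets-injective {n} {f} {g} eq = lookup-injective λ x →
      toℕ-injective (ℕ.≤-antisym (≤′ g f (sym eq) x) (≤′ f g eq x))
      where
      ≤′ : ∀ (f g : Vec (Fin n) size) → levelSets f ≡ levelSets g → ∀ x → toℕ (lookup g x) ≤ toℕ (lookup f x)
      ≤′ f g eq x = ℕ.≤-pred (to (levelSets-isLevelSets g (suc (lookup f x)) x)
        (subst (λ I → x ∈ lookup I (suc (lookup f x))) eq
          (from (levelSets-isLevelSets f (suc (lookup f x)) x) ℕ.≤-refl)))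

    module _ {n} (f : Vec (Fin n) size) I (L : IsLevelSets f I) where

      private
        φ : Fin size → ℕ
        φ x = toℕ (lookup f x)

      ∈-inject₁⇔ : ∀ i x → x ∈ lookup I (inject₁ i) ⇔ φ x < toℕ i
      ∈-inject₁⇔ i x = subst (λ m → x ∈ lookup I (inject₁ i) ⇔ φ x < m) (toℕ-inject₁ i) (L (inject₁ i) x)

      -- A value below `i + 1` but not below `i` equals `i`: consecutive level sets differ by a
      -- fibre. Naturality of the differences thus concerns pairs with equal values.
      ∈-fibre⇔ : ∀ i x → x ∈ lookup I (suc i) ─ lookup I (inject₁ i) ⇔ φ x ≡ toℕ i
      ∈-fibre⇔ i x = mk⇔
        (λ x∈ → ℕ.≤-antisym (ℕ.≤-pred (to (L (suc i) x) (p─q⊆p (lookup I (suc i)) (lookup I (inject₁ i)) x∈)))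
                            (ℕ.≮⇒≥ (x∈p─q⇒x∉q (lookup I (suc i)) (lookup I (inject₁ i)) x∈ ∘ from (∈-inject₁⇔ i x))))
        (λ φx≡i → x∈p∧x∉q⇒x∈p─q (from (L (suc i) x) (s≤s (ℕ.≤-reflexive φx≡i)))
                                (ℕ.<-irrefl φx≡i ∘ to (∈-inject₁⇔ i x)))

      omegaOrderPreserving⇒isMultipath : OmegaOrderPreserving P f → IsMultipath P I
      omegaOrderPreserving⇒isMultipath (mono , strict) =
        ⊆-antisym (λ {x} x∈ → contradiction (to (L zero x) x∈) (λ ())) ⊥⊆ ,
        ⊆-antisym ⊆⊤ (λ {x} _ → from (L (fromℕ n) x)
          (subst (φ x <_) (sym (toℕ-fromℕ n)) (toℕ<n (lookup f x)))) ,
        (λ i x y y≼x x∈ → from (L i y) (ℕ.≤-<-trans (mono y x y≼x) (to (L i x) x∈))) ,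
        (λ i {x} x∈ → from (L (suc i) x) (ℕ.m<n⇒m<1+n (to (∈-inject₁⇔ i x) x∈))) ,
        -- A label inversion inside a fibre would make `x ≺ y`, and `strict` would then separate two
        -- equal values.
        (λ i x y x∈ y∈ x≼y → ℕ.≮⇒≥ λ ωy<ωx → ℕ.<-irrefl
          (trans (to (∈-fibre⇔ i x) x∈) (sym (to (∈-fibre⇔ i y) y∈)))
          (strict y x (x≼y , λ { refl → ℕ.<-irrefl refl ωy<ωx }) ωy<ωx))

      -- Monotonicity holds because the level set of index `suc (lookup f y)` contains `y` and is an
      -- ideal. For strictness, equal values would put both elements in one fibre, whose naturality
      -- contradicts the order of the labels.
      isMultipath⇒omegaOrderPreserving : IsMultipath P I → OmegaOrderPreserving P f
      isMultipath⇒omegaOrderPreserving (_ , _ , ideals , _ , natural) = mono , strict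
        where
        mono : ∀ x y → x ≼ y → φ x ≤ φ y
        mono x y x≼y = ℕ.≤-pred (to (L (suc (lookup f y)) x)
          (ideals (suc (lookup f y)) y x x≼y (from (L (suc (lookup f y)) y) ℕ.≤-refl)))
        strict : ∀ x y → y ≺ x → ω x < ω y → φ y < φ x
        strict x y (y≼x , _) ωx<ωy = ℕ.≤∧≢⇒< (mono y x y≼x) λ φy≡φx →
          ℕ.<⇒≱ ωx<ωy (natural (lookup f x) y x
            (from (∈-fibre⇔ (lookup f x) y) φy≡φx) (from (∈-fibre⇔ (lookup f x) x) refl) y≼x)

    ⊆-chain : ∀ {n} (I : Vec (Subset size) (suc n)) →
              (∀ (i : Fin n) → lookup I (inject₁ i) ⊆ lookup I (suc i)) →
              ∀ i j → toℕ i ≤ toℕ j → lookup I i ⊆ lookup I j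
    ⊆-chain I           chain zero    zero    _         = id
    ⊆-chain (_ ∷ J ∷ I) chain zero    (suc j) _         = ⊆-chain (J ∷ I) (chain ∘ suc) zero j z≤n ∘ chain zero
    ⊆-chain (_ ∷ J ∷ I) chain (suc i) (suc j) (s≤s i≤j) = ⊆-chain (J ∷ I) (chain ∘ suc) i j i≤j

    -- The value at `x` is the least `i` for which the set of index `suc i` contains `x`. It exists
    -- because the last set is `⊤`, and it describes membership at every index because the sets
    -- increase from `⊥`.
    isMultipath⇒isLevelSets : ∀ {n} (I : Vec (Subset size) (suc (suc n))) → IsMultipath P I →
                              ∃ λ f → IsLevelSets f I
    isMultipath⇒isLevelSets {n} I (first≡⊥ , last≡⊤ , _ , chain , _) =
      tabulate level , λ i x → subst (λ l → x ∈ lookup I i ⇔ toℕ l < toℕ i)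
        (sym (lookup∘tabulate level x)) (mk⇔ (∈⇒level< i x) (level<⇒∈ i x))
      where
      search : ∀ x → ∃ λ i → ¬ x ∉ lookup I (suc i) × (∀ (j : Fin.Fin′ i) → x ∉ lookup I (suc (inject j)))
      -- The search returns the least index at which a predicate fails. Applied to non-membership it
      -- gives a double negation, which decidability removes in `level<⇒∈`.
      search x = ¬∀⟶∃¬-smallest (suc n) (λ i → x ∉ lookup I (suc i))
        (λ i → x ∈? lookup I (suc i) →-dec no λ ())
        (λ all∉ → all∉ (fromℕ n) (subst (x ∈_) (sym last≡⊤) ∈⊤))
      level : Fin size → Fin (suc n)
      level x = proj₁ (search x)
      ∈⇒level< : ∀ i x → x ∈ lookup I i → toℕ (level x) < toℕ i
      ∈⇒level< zero    x x∈ = contradiction (subst (x ∈_) first≡⊥ x∈) ∉⊥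
      ∈⇒level< (suc i) x x∈ = s≤s (ℕ.≮⇒≥ λ i<level →
        proj₂ (proj₂ (search x)) (Fin.fromℕ< i<level)
          (subst (λ j → x ∈ lookup I (suc j)) (sym (Fin.toℕ-injective
            (trans (Fin.toℕ-inject (Fin.fromℕ< i<level)) (Fin.toℕ-fromℕ< i<level)))) x∈))
      level<⇒∈ : ∀ i x → toℕ (level x) < toℕ i → x ∈ lookup I i
      level<⇒∈ i x level<i = ⊆-chain I chain (suc (level x)) i level<i
        (decidable-stable (x ∈? lookup I (suc (level x))) (proj₁ (proj₂ (search x))))

    numOmegaOrderPreserving≡numMultipaths : ∀ n .{{_ : NonZero n}} →
      numOmegaOrderPreserving P n ≡ numMultipaths P n
    numOmegaOrderPreserving≡numMultipaths (suc n) = count-bijection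
      (omegaOrderPreserving? P) (isMultipath? P)
      (allVecs-isEnumeration (allFin-isEnumeration (suc n)) size)
      (allVecs-isEnumeration (allSubsets-isEnumeration size) (suc (suc n)))
      levelSets levelSets-injective
      (λ f → omegaOrderPreserving⇒isMultipath f (levelSets f) (levelSets-isLevelSets f))
      (λ I mp → let f , L = isMultipath⇒isLevelSets I mp in
        f , isMultipath⇒omegaOrderPreserving f I L mp , isLevelSets-unique f L (levelSets-isLevelSets f))

-- Finite differences and formal power series over ℚ.

module PowerSeriesAlgebra where

  open import Data.Rational.Base using (_+_; _*_; -_)
  open import Data.Rational.Properties
    using (+-assoc; +-comm; +-identityˡ; +-identityʳ; *-assoc; *-identityˡ;
           *-zeroˡ; *-zeroʳ; *-distribˡ-+; *-distribʳ-+)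

  open SemiringSum (CommutativeRing.semiring ℚ.+-*-commutativeRing)
    using (sum; sum-syntax; sum⁺-syntax; sum-cong-≗; ∑-comm; ∑-distrib-+; *-distribˡ-sum; sum-replicate-zero)

  module ℚ+ where
    open CommutativeSemigroupProperties
      (CommutativeMonoid.commutativeSemigroup ℚ.+-0-commutativeMonoid) public
      using (interchange)
    open GroupProperties ℚ.+-0-group public using (∙-cancelˡ)

  module ℚ* = CommutativeSemigroupProperties
    (CommutativeMonoid.commutativeSemigroup ℚ.*-1-commutativeMonoid)

  -- Natural numbers as rationals

  -- Since `ℕ→ℚ` normalises by a gcd, it does not reduce on variables; the computation takes place
  -- in unnormalised fractions with denominator 1.
  ℕ→ℚ-+ : ∀ m n → ℕ→ℚ (m ℕ.+ n) ≡ ℕ→ℚ m + ℕ→ℚ n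
  ℕ→ℚ-+ m n = ℚ.toℚᵘ-injective (begin
    toℚᵘ (ℕ→ℚ (m ℕ.+ n))                ≈⟨ ℚ.toℚᵘ-fromℚᵘ (mkℚᵘ (ℤ.+ (m ℕ.+ n)) 0) ⟩
    mkℚᵘ (ℤ.+ (m ℕ.+ n)) 0                ≈⟨ *≡* (cong (ℤ._* (ℤ.+ 1)) (cong₂ ℤ._+_ (sym (ℤ.*-identityʳ (ℤ.+ m))) (sym (ℤ.*-identityʳ (ℤ.+ n))))) ⟩
    mkℚᵘ (ℤ.+ m) 0 ℚᵘ.+ mkℚᵘ (ℤ.+ n) 0      ≈⟨ ℚᵘ.+-cong (ℚ.toℚᵘ-fromℚᵘ (mkℚᵘ (ℤ.+ m) 0)) (ℚ.toℚᵘ-fromℚᵘ (mkℚᵘ (ℤ.+ n) 0)) ⟨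
    toℚᵘ (ℕ→ℚ m) ℚᵘ.+ toℚᵘ (ℕ→ℚ n)      ≈⟨ ℚ.toℚᵘ-homo-+ (ℕ→ℚ m) (ℕ→ℚ n) ⟨
    toℚᵘ (ℕ→ℚ m + ℕ→ℚ n)                ∎)
    where open import Relation.Binary.Reasoning.Setoid ℚᵘ.≃-setoid

  ℕ→ℚ-* : ∀ m n → ℕ→ℚ (m ℕ.* n) ≡ ℕ→ℚ m * ℕ→ℚ n
  ℕ→ℚ-* zero    n = sym (*-zeroˡ (ℕ→ℚ n))
  ℕ→ℚ-* (suc m) n = begin
    ℕ→ℚ (n ℕ.+ m ℕ.* n)          ≡⟨ ℕ→ℚ-+ n (m ℕ.* n) ⟩
    ℕ→ℚ n + ℕ→ℚ (m ℕ.* n)        ≡⟨ cong₂ _+_ (sym (*-identityˡ (ℕ→ℚ n))) (ℕ→ℚ-* m n) ⟩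
    1ℚ * ℕ→ℚ n + ℕ→ℚ m * ℕ→ℚ n   ≡⟨ *-distribʳ-+ (ℕ→ℚ n) 1ℚ (ℕ→ℚ m) ⟨
    (1ℚ + ℕ→ℚ m) * ℕ→ℚ n         ≡⟨ cong (_* ℕ→ℚ n) (ℕ→ℚ-+ 1 m) ⟨
    ℕ→ℚ (suc m) * ℕ→ℚ n          ∎
    where open ≡-Reasoning

  module ∑ℕ = SemiringSum ℕ.+-*-semiring

  ℕ→ℚ-sum : ∀ m (f : Fin m → ℕ) → ℕ→ℚ (∑ℕ.sum f) ≡ ∑[ i < m ] ℕ→ℚ (f i)
  ℕ→ℚ-sum zero    f = refl
  ℕ→ℚ-sum (suc m) f = trans (ℕ→ℚ-+ (f zero) (∑ℕ.sum (f ∘ suc))) (cong (ℕ→ℚ (f zero) +_) (ℕ→ℚ-sum m (f ∘ suc)))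

  -- Sequences annihilated by iterated differences

  shift : (ℕ → ℚ) → (ℕ → ℚ)
  shift f n = f (suc n)

  Δ : (ℕ → ℚ) → (ℕ → ℚ)
  Δ f n = f (suc n) + - f n

  -- The sequences whose `d`-fold difference is zero, that is, those given by rational polynomials
  -- of degree less than `d`. This form covers evaluated coefficient lists and binomial coefficients
  -- alike.
  data Annihilated : ℕ → (ℕ → ℚ) → Set where
    zero : ∀ {f} → (∀ n → f n ≡ 0ℚ) → Annihilated zero f
    suc  : ∀ {d f} → Annihilated d (Δ f) → Annihilated (suc d) f

  private
    [a+b]-[c+d] : ∀ a b c d → (a + b) + - (c + d) ≡ (a + - c) + (b + - d)
    [a+b]-[c+d] a b c d =
      trans (cong (a + b +_) (ℚ.neg-distrib-+ c d)) (ℚ+.interchange a b (- c) (- d))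

  annihilated-cong : ∀ {d f g} → f ≗ g → Annihilated d f → Annihilated d g
  annihilated-cong f≗g (zero f≗0) = zero λ n → trans (sym (f≗g n)) (f≗0 n)
  annihilated-cong f≗g (suc af)   =
    suc (annihilated-cong (λ n → cong₂ (λ x y → x + - y) (f≗g (suc n)) (f≗g n)) af)

  annihilated-0 : ∀ d {f} → (∀ n → f n ≡ 0ℚ) → Annihilated d f
  annihilated-0 zero    f≗0 = zero f≗0
  annihilated-0 (suc d) f≗0 =
    suc (annihilated-0 d (λ n → cong₂ (λ x y → x + - y) (f≗0 (suc n)) (f≗0 n)))

  annihilated-≤ : ∀ {d e f} → d ≤ e → Annihilated d f → Annihilated e f
  annihilated-≤ {e = e} z≤n       (zero f≗0) = annihilated-0 e f≗0
  annihilated-≤         (s≤s d≤e) (suc af)   = suc (annihilated-≤ d≤e af)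

  annihilated-+ : ∀ {d f g} → Annihilated d f → Annihilated d g →
                  Annihilated d (λ n → f n + g n)
  annihilated-+         (zero f≗0) (zero g≗0) = zero λ n → cong₂ _+_ (f≗0 n) (g≗0 n)
  annihilated-+ {f = f} {g} (suc af) (suc ag) = suc (annihilated-cong
    (λ n → sym ([a+b]-[c+d] (f (suc n)) (g (suc n)) (f n) (g n))) (annihilated-+ af ag))

  annihilated-scale : ∀ {d f} c → Annihilated d f → Annihilated d (λ n → c * f n)
  annihilated-scale         c (zero f≗0) = zero λ n → trans (cong (c *_) (f≗0 n)) (*-zeroʳ c)
  annihilated-scale {f = f} c (suc af)   = suc (annihilated-cong
    (λ n → trans (*-distribˡ-+ c (f (suc n)) (- f n))
                 (cong (c * f (suc n) +_) (sym (ℚ.neg-distribʳ-* c (f n)))))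
    (annihilated-scale c af))

  annihilated-shift : ∀ {d f} → Annihilated d f → Annihilated d (shift f)
  annihilated-shift         (zero f≗0) = zero (f≗0 ∘ suc)
  annihilated-shift {f = f} (suc af) = suc (annihilated-shift {f = Δ f} af)

  annihilated-const : ∀ d c → Annihilated (suc d) (λ _ → c)
  annihilated-const d c = suc (annihilated-0 d (λ _ → ℚ.+-inverseʳ c))

  -- Discrete product rule: the difference of `n * f n` is `n * Δ f n + f (suc n)`. Induction
  -- handles the first summand, invariance under `shift` the second.
  annihilated-n* : ∀ {d f} → Annihilated d f → Annihilated (suc d) (λ n → ℕ→ℚ n * f n)
  annihilated-n* {f = f} (zero f≗0) =
    annihilated-0 1 (λ n → trans (cong (ℕ→ℚ n *_) (f≗0 n)) (*-zeroʳ (ℕ→ℚ n)))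
  annihilated-n* {f = f} (suc af)   = suc (annihilated-cong Δ[n*f]
    (annihilated-+ (annihilated-n* af) (annihilated-shift {f = f} (suc af))))
    where
    open ≡-Reasoning
    Δ[n*f] : ∀ n → ℕ→ℚ n * Δ f n + f (suc n) ≡ Δ (λ n → ℕ→ℚ n * f n) n
    Δ[n*f] n = begin
      q * (f′ + - f n) + f′               ≡⟨ cong (_+ f′) (*-distribˡ-+ q f′ (- f n)) ⟩
      (q * f′ + q * - f n) + f′           ≡⟨ +-comm _ f′ ⟩
      f′ + (q * f′ + q * - f n)           ≡⟨ +-assoc f′ _ _ ⟨
      (f′ + q * f′) + q * - f n           ≡⟨ cong₂ _+_ (cong (_+ q * f′) (sym (*-identityˡ f′))) (sym (ℚ.neg-distribʳ-* q (f n))) ⟩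
      (1ℚ * f′ + q * f′) + - (q * f n)    ≡⟨ cong (_+ - (q * f n)) (*-distribʳ-+ f′ 1ℚ q) ⟨
      (1ℚ + q) * f′ + - (q * f n)         ≡⟨ cong (λ r → r * f′ + - (q * f n)) (ℕ→ℚ-+ 1 n) ⟨
      ℕ→ℚ (suc n) * f′ + - (q * f n)      ∎
      where
      q  = ℕ→ℚ n
      f′ = f (suc n)

  -- Follows the Horner form of `eval`, in which each coefficient costs one multiplication by `n`.
  annihilated-eval : ∀ p → Annihilated (length p) (λ n → eval p (ℕ→ℚ n))
  annihilated-eval []      = zero λ _ → refl
  annihilated-eval (a ∷ p) = annihilated-+
    (annihilated-const (length p) a) (annihilated-n* (annihilated-eval p))

  -- By Pascal's rule the difference of `n C suc k` is `n C k`.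
  annihilated-C : ∀ k → Annihilated (suc k) (λ n → ℕ→ℚ (n C k))
  annihilated-C zero    = annihilated-cong
    (λ n → cong ℕ→ℚ (sym (nC0≡1 n))) (annihilated-const 0 1ℚ)
  annihilated-C (suc k) = suc (annihilated-cong pascal (annihilated-C k))
    where
    open ≡-Reasoning
    pascal : ∀ n → ℕ→ℚ (n C k) ≡ ℕ→ℚ (suc n C suc k) + - ℕ→ℚ (n C suc k)
    pascal n = begin
      a                                    ≡⟨ +-identityʳ a ⟨
      a + 0ℚ                               ≡⟨ cong (a +_) (ℚ.+-inverseʳ b) ⟨
      a + (b + - b)                        ≡⟨ +-assoc a b (- b) ⟨
      (a + b) + - b                        ≡⟨ cong (_+ - b) (ℕ→ℚ-+ (n C k) (n C suc k)) ⟨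
      ℕ→ℚ (n C k ℕ.+ n C suc k) + - b      ≡⟨ cong (λ m → ℕ→ℚ m + - b) (nCk+nC[k+1]≡[n+1]C[k+1] n k) ⟩
      ℕ→ℚ (suc n C suc k) + - b            ∎
      where
      a = ℕ→ℚ (n C k)
      b = ℕ→ℚ (n C suc k)

  annihilated-sum : ∀ {d} m {F : ℕ → ℕ → ℚ} → (∀ i → i ℕ.< m → Annihilated d (F i)) →
                    Annihilated d (λ n → ∑[ i < m ] F (toℕ i) n)
  annihilated-sum {d} zero    aF = annihilated-0 d (λ _ → refl)
  annihilated-sum     (suc m) aF = annihilated-+ (aF 0 (s≤s z≤n))
    (annihilated-sum m (λ i i<m → aF (suc i) (s≤s i<m)))

  -- The differences of `f` and `g` also agree from 1 on, so by induction they agree at 0;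
  -- cancelling `f 1 ≡ g 1` there leaves the values at 0.
  annihilated-extend : ∀ {d f g} → Annihilated d f → Annihilated d g →
                       (∀ n → f (suc n) ≡ g (suc n)) → f 0 ≡ g 0
  annihilated-extend         (zero f≗0) (zero g≗0) f≗g = trans (f≗0 0) (sym (g≗0 0))
  annihilated-extend {f = f} {g} (suc af) (suc ag) f≗g = ℚ.neg-injective
    (ℚ+.∙-cancelˡ (f 1) _ _ (trans
      (annihilated-extend af ag (λ n → cong₂ (λ x y → x + - y) (f≗g (suc n)) (f≗g n)))
      (cong (_+ - g 0) (sym (f≗g 0)))))

  -- The commutative monoid of power series under multiplication

  ⊛-cong : ∀ {f f′ g g′} → f ≗ f′ → g ≗ g′ → f ⊛ g ≗ f′ ⊛ g′
  ⊛-cong f≗f′ g≗g′ n =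
    sum-cong-≗ {suc n} (λ i → cong₂ _*_ (f≗f′ (toℕ i)) (g≗g′ (n ∸ toℕ i)))

  ⊛-zeroˡ : ∀ g → (λ _ → 0ℚ) ⊛ g ≗ (λ _ → 0ℚ)
  ⊛-zeroˡ g n = trans (sum-cong-≗ {suc n} (λ i → *-zeroˡ (g (n ∸ toℕ i)))) (sum-replicate-zero (suc n))

  ⊛-identityˡ : ∀ f → 𝟙 ⊛ f ≗ f
  ⊛-identityˡ f zero    = trans (+-identityʳ _) (*-identityˡ (f 0))
  ⊛-identityˡ f (suc n) = trans (cong₂ _+_ (*-identityˡ (f (suc n))) (⊛-zeroˡ f n)) (+-identityʳ _)

  -- By definition a coefficient of a product splits off its first term; this splits off the last
  -- one, which commutativity requires.
  ⊛-sucʳ : ∀ f g n → (f ⊛ g) (suc n) ≡ (f ⊛ shift g) n + f (suc n) * g 0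
  ⊛-sucʳ f g zero    = begin
    f 0 * g 1 + (f 1 * g 0 + 0ℚ)   ≡⟨ cong (f 0 * g 1 +_) (+-comm (f 1 * g 0) 0ℚ) ⟩
    f 0 * g 1 + (0ℚ + f 1 * g 0)   ≡⟨ +-assoc (f 0 * g 1) 0ℚ (f 1 * g 0) ⟨
    f 0 * g 1 + 0ℚ + f 1 * g 0     ∎
    where open ≡-Reasoning
  ⊛-sucʳ f g (suc n) = trans (cong (f 0 * g (suc (suc n)) +_) (⊛-sucʳ (shift f) g n))
    (sym (+-assoc (f 0 * g (suc (suc n))) _ _))

  ⊛-comm : ∀ f g → f ⊛ g ≗ g ⊛ f
  ⊛-comm f g zero    = cong (_+ 0ℚ) (ℚ.*-comm (f 0) (g 0))
  ⊛-comm f g (suc n) = begin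
    f 0 * g (suc n) + (shift f ⊛ g) n   ≡⟨ cong₂ _+_ (ℚ.*-comm (f 0) _) (⊛-comm (shift f) g n) ⟩
    g (suc n) * f 0 + (g ⊛ shift f) n   ≡⟨ +-comm _ ((g ⊛ shift f) n) ⟩
    (g ⊛ shift f) n + g (suc n) * f 0   ≡⟨ ⊛-sucʳ g f n ⟨
    (g ⊛ f) (suc n)                     ∎
    where open ≡-Reasoning

  ⊛-distribʳ-+ : ∀ f g h → (λ n → f n + g n) ⊛ h ≗ (λ n → (f ⊛ h) n + (g ⊛ h) n)
  ⊛-distribʳ-+ f g h n = trans
    (sum-cong-≗ {suc n} (λ i → *-distribʳ-+ (h (n ∸ toℕ i)) (f (toℕ i)) (g (toℕ i))))
    (∑-distrib-+ {suc n} (λ i → f (toℕ i) * h (n ∸ toℕ i)) (λ i → g (toℕ i) * h (n ∸ toℕ i)))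

  ⊛-scaleˡ : ∀ c f g → (λ n → c * f n) ⊛ g ≗ (λ n → c * (f ⊛ g) n)
  ⊛-scaleˡ c f g n = trans
    (sum-cong-≗ {suc n} (λ i → *-assoc c (f (toℕ i)) (g (n ∸ toℕ i))))
    (sym (*-distribˡ-sum {suc n} c (λ i → f (toℕ i) * g (n ∸ toℕ i))))

  -- Induction on the coefficient, since `shift (f ⊛ g)` unfolds to the sum of `f 0` times `shift g`
  -- and `shift f ⊛ g`.
  ⊛-assoc : ∀ f g h → (f ⊛ g) ⊛ h ≗ f ⊛ (g ⊛ h)
  ⊛-assoc f g h zero    = cong (_+ 0ℚ) (begin
    (f 0 * g 0 + 0ℚ) * h 0   ≡⟨ cong (_* h 0) (+-identityʳ (f 0 * g 0)) ⟩
    f 0 * g 0 * h 0          ≡⟨ *-assoc (f 0) (g 0) (h 0) ⟩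
    f 0 * (g 0 * h 0)        ≡⟨ cong (f 0 *_) (+-identityʳ (g 0 * h 0)) ⟨
    f 0 * (g 0 * h 0 + 0ℚ)   ∎)
    where open ≡-Reasoning
  ⊛-assoc f g h (suc n) = begin
    (f 0 * g 0 + 0ℚ) * h (suc n) + (shift (f ⊛ g) ⊛ h) n
      ≡⟨ cong₂ _+_ (trans (cong (_* h (suc n)) (+-identityʳ (f 0 * g 0))) (*-assoc (f 0) (g 0) (h (suc n))))
                   (⊛-distribʳ-+ (λ m → f 0 * g (suc m)) (shift f ⊛ g) h n) ⟩
    f 0 * (g 0 * h (suc n)) + (((λ m → f 0 * g (suc m)) ⊛ h) n + ((shift f ⊛ g) ⊛ h) n)
      ≡⟨ +-assoc (f 0 * (g 0 * h (suc n))) _ _ ⟨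
    (f 0 * (g 0 * h (suc n)) + ((λ m → f 0 * g (suc m)) ⊛ h) n) + ((shift f ⊛ g) ⊛ h) n
      ≡⟨ cong₂ _+_ (cong (f 0 * (g 0 * h (suc n)) +_) (⊛-scaleˡ (f 0) (shift g) h n)) (⊛-assoc (shift f) g h n) ⟩
    (f 0 * (g 0 * h (suc n)) + f 0 * (shift g ⊛ h) n) + (shift f ⊛ (g ⊛ h)) n
      ≡⟨ cong (_+ (shift f ⊛ (g ⊛ h)) n) (*-distribˡ-+ (f 0) (g 0 * h (suc n)) ((shift g ⊛ h) n)) ⟨
    f 0 * (g ⊛ h) (suc n) + (shift f ⊛ (g ⊛ h)) n
      ∎
    where open ≡-Reasoning

  ⊛-commutativeMonoid : CommutativeMonoid _ _
  ⊛-commutativeMonoid = record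
    { Carrier = PowerSeries
    ; _≈_     = _≗_
    ; _∙_     = _⊛_
    ; ε       = 𝟙
    ; isCommutativeMonoid = record
      { isMonoid = record
        { isSemigroup = record
          { isMagma = record
            { isEquivalence = Setoid.isEquivalence (ℕ →-setoid ℚ)
            ; ∙-cong        = ⊛-cong
            }
          ; assoc = ⊛-assoc
          }
        ; identity = ⊛-identityˡ , λ f n → trans (⊛-comm f 𝟙 n) (⊛-identityˡ f n)
        }
      ; comm = ⊛-comm
      }
    }

  open CommutativeMonoid ⊛-commutativeMonoid public using (setoid; commutativeSemigroup)
    renaming (∙-congˡ to ⊛-congˡ; ∙-congʳ to ⊛-congʳ; identityʳ to ⊛-identityʳ)
  open CommutativeSemigroupProperties commutativeSemigroup
    using (interchange; x∙yz≈y∙xz; xy∙z≈y∙xz)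

  -- Agreement is asked only for `k ≤ n`, so that `[1-X]^[1+s]-cancel` can be applied under the sum.
  ∑₁-·-cong : ∀ n (c : ℕ → ℕ) (F G : ℕ → PowerSeries) → (∀ k → k ≤ n → F k ≗ G k) →
              ∑₁ n (λ k → c k · F k) ≗ ∑₁ n (λ k → c k · G k)
  ∑₁-·-cong n c F G F≗G m =
    sum-cong-≗ {n} (λ i → cong (ℕ→ℚ (c (suc (toℕ i))) *_) (F≗G (suc (toℕ i)) (toℕ<n i) m))

  ⊛-linear : ∀ f n (c : ℕ → ℕ) (F : ℕ → PowerSeries) →
             f ⊛ ∑₁ n (λ k → c k · F k) ≗ ∑₁ n (λ k → c k · (f ⊛ F k))
  ⊛-linear f n c F m = begin
    ∑[ j ≤ m ] (f (toℕ j) * ∑[ i < n ] (c′ i * F′ i j))     ≡⟨ sum-cong-≗ {suc m} (λ j → *-distribˡ-sum (f (toℕ j)) (λ i → c′ i * F′ i j)) ⟩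
    ∑[ j ≤ m ] ∑[ i < n ] (f (toℕ j) * (c′ i * F′ i j))     ≡⟨ ∑-comm {suc m} {n} (λ j i → f (toℕ j) * (c′ i * F′ i j)) ⟩
    ∑[ i < n ] ∑[ j ≤ m ] (f (toℕ j) * (c′ i * F′ i j))     ≡⟨ sum-cong-≗ (λ i → sum-cong-≗ {suc m} (λ j → ℚ*.x∙yz≈y∙xz (f (toℕ j)) (c′ i) (F′ i j))) ⟩
    ∑[ i < n ] ∑[ j ≤ m ] (c′ i * (f (toℕ j) * F′ i j))     ≡⟨ sum-cong-≗ (λ i → *-distribˡ-sum {suc m} (c′ i) (λ j → f (toℕ j) * F′ i j)) ⟨
    ∑[ i < n ] (c′ i * ∑[ j ≤ m ] (f (toℕ j) * F′ i j))     ∎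
    where
    open ≡-Reasoning
    c′ = λ i → ℕ→ℚ (c (suc (toℕ i)))
    F′ = λ i j → F (suc (toℕ i)) (m ∸ toℕ j)

  -- Powers of X / (1 - X)

  X⊛-suc : ∀ f n → (X ⊛ f) (suc n) ≡ f n
  X⊛-suc f n = begin
    0ℚ * f (suc n) + (shift X ⊛ f) n   ≡⟨ cong₂ _+_ (*-zeroˡ (f (suc n))) (⊛-congʳ {f} shiftX n) ⟩
    0ℚ + (𝟙 ⊛ f) n                     ≡⟨ +-identityˡ _ ⟩
    (𝟙 ⊛ f) n                          ≡⟨ ⊛-identityˡ f n ⟩
    f n                                ∎
    where
    open ≡-Reasoning
    shiftX : shift X ≗ 𝟙
    shiftX zero    = refl
    shiftX (suc _) = refl

  -- The hockey-stick identity: `1/[1-X]` takes partial sums and `X` shifts. As `1/[1-X]` is its own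
  -- shift, each new coefficient adds one term to the previous one, as in Pascal's rule.
  partialSums-pascal : ∀ k → 1/[1-X] ⊛ (X ⊛ λ n → ℕ→ℚ (n C k)) ≗ λ n → ℕ→ℚ (n C suc k)
  partialSums-pascal k zero    =
    trans (+-identityʳ _) (trans (*-identityˡ _) (trans (+-identityʳ _) (*-zeroˡ (ℕ→ℚ (0 C k)))))
  partialSums-pascal k (suc n) = begin
    1ℚ * (X ⊛ B) (suc n) + (1/[1-X] ⊛ (X ⊛ B)) n   ≡⟨ cong₂ _+_ (trans (*-identityˡ _) (X⊛-suc B n)) (partialSums-pascal k n) ⟩
    ℕ→ℚ (n C k) + ℕ→ℚ (n C suc k)                  ≡⟨ ℕ→ℚ-+ (n C k) (n C suc k) ⟨
    ℕ→ℚ (n C k ℕ.+ n C suc k)                      ≡⟨ cong ℕ→ℚ (nCk+nC[k+1]≡[n+1]C[k+1] n k) ⟩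
    ℕ→ℚ (suc n C suc k)                            ∎
    where
    open ≡-Reasoning
    B = λ n → ℕ→ℚ (n C k)

  -- Each further factor `X ⊛ 1/[1-X]` raises the lower index by one through `partialSums-pascal`.
  1/[1-X]⊛[X/[1-X]]^k : ∀ k → 1/[1-X] ⊛ (X ⊛ 1/[1-X]) ^ k ≗ λ n → ℕ→ℚ (n C k)
  1/[1-X]⊛[X/[1-X]]^k zero    n =
    trans (⊛-identityʳ 1/[1-X] n) (cong ℕ→ℚ (sym (nC0≡1 n)))
  1/[1-X]⊛[X/[1-X]]^k (suc k) = begin
    G ⊛ ((X ⊛ G) ⊛ (X ⊛ G) ^ k)        ≈⟨ x∙yz≈y∙xz G (X ⊛ G) ((X ⊛ G) ^ k) ⟩
    (X ⊛ G) ⊛ (G ⊛ (X ⊛ G) ^ k)        ≈⟨ ⊛-congˡ {X ⊛ G} (1/[1-X]⊛[X/[1-X]]^k k) ⟩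
    (X ⊛ G) ⊛ (λ n → ℕ→ℚ (n C k))      ≈⟨ xy∙z≈y∙xz X G (λ n → ℕ→ℚ (n C k)) ⟩
    G ⊛ (X ⊛ λ n → ℕ→ℚ (n C k))        ≈⟨ partialSums-pascal k ⟩
    (λ n → ℕ→ℚ (n C suc k))            ∎
    where
    open import Relation.Binary.Reasoning.Setoid setoid
    G = 1/[1-X]

  -- One factor `𝟙 ⊖ X` cancels the leading `1/[1-X]`, and `k` more cancel the denominators of the
  -- power. By `k ≤ s` the remaining exponent `s ∸ k` is a true difference.
  [1-X]^[1+s]-cancel : ∀ {s k} → k ≤ s →
    (𝟙 ⊖ X) ^ suc s ⊛ (1/[1-X] ⊛ (X ⊛ 1/[1-X]) ^ k) ≗ X ^ k ⊛ (𝟙 ⊖ X) ^ (s ∸ k)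
  [1-X]^[1+s]-cancel {s} {zero} z≤n = begin
    (U ⊛ U ^ s) ⊛ (G ⊛ 𝟙)   ≈⟨ interchange U (U ^ s) G 𝟙 ⟩
    (U ⊛ G) ⊛ (U ^ s ⊛ 𝟙)   ≈⟨ ⊛-cong 1/[1-X]-inverse (⊛-identityʳ (U ^ s)) ⟩
    𝟙 ⊛ U ^ s               ∎
    where
    open import Relation.Binary.Reasoning.Setoid setoid
    U = 𝟙 ⊖ X
    G = 1/[1-X]
  [1-X]^[1+s]-cancel {suc s} {suc k} (s≤s k≤s) = begin
    (U ⊛ U ^ suc s) ⊛ (G ⊛ ((X ⊛ G) ⊛ (X ⊛ G) ^ k))   ≈⟨ ⊛-congˡ {U ⊛ U ^ suc s} (x∙yz≈y∙xz G (X ⊛ G) ((X ⊛ G) ^ k)) ⟩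
    (U ⊛ U ^ suc s) ⊛ ((X ⊛ G) ⊛ (G ⊛ (X ⊛ G) ^ k))   ≈⟨ interchange U (U ^ suc s) (X ⊛ G) (G ⊛ (X ⊛ G) ^ k) ⟩
    (U ⊛ (X ⊛ G)) ⊛ (U ^ suc s ⊛ (G ⊛ (X ⊛ G) ^ k))   ≈⟨ ⊛-cong U⊛X⊛G ([1-X]^[1+s]-cancel k≤s) ⟩
    X ⊛ (X ^ k ⊛ U ^ (s ∸ k))                         ≈⟨ ⊛-assoc X (X ^ k) (U ^ (s ∸ k)) ⟨
    (X ⊛ X ^ k) ⊛ U ^ (s ∸ k)                         ∎
    where
    open import Relation.Binary.Reasoning.Setoid setoid
    U = 𝟙 ⊖ X
    G = 1/[1-X]
    U⊛X⊛G : U ⊛ (X ⊛ G) ≗ X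
    U⊛X⊛G = begin
      U ⊛ (X ⊛ G)   ≈⟨ x∙yz≈y∙xz U X G ⟩
      X ⊛ (U ⊛ G)   ≈⟨ ⊛-congˡ {X} 1/[1-X]-inverse ⟩
      X ⊛ 𝟙         ≈⟨ ⊛-identityʳ X ⟩
      X             ∎

-- The generating functions of a non-empty labeled poset.

module _ (P : LabeledPoset) .{{nonEmpty : NonZero (LabeledPoset.size P)}} where

  open LabeledPoset P using (size)
  open Multipaths
  open PowerSeriesAlgebra
  open SemiringSum (CommutativeRing.semiring ℚ.+-*-commutativeRing) using (sum-syntax; sum-cong-≗)

  -- The meeting point of the argument: its coefficients count multi-paths, are polynomial in `n`,
  -- and are those of the series in powers of `X ⊛ 1/[1-X]`.
  binomialSum : PowerSeries
  binomialSum = ∑₁ size (λ k → numPaths P k · λ n → ℕ→ℚ (n C k))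

  multipathSeries≗binomialSum : ∑₁^∞ (numMultipaths P) ≗ binomialSum
  multipathSeries≗binomialSum n = begin
    ∑₁^∞ (numMultipaths P) n
      ≡⟨ coefficient n ⟩
    ℕ→ℚ (numMultipaths P n)
      ≡⟨ cong ℕ→ℚ (numMultipaths-binomial P n) ⟩
    ℕ→ℚ (∑ℕ.sum {size} (λ k → (n C suc (toℕ k)) ℕ.* numPaths P (suc (toℕ k))))
      ≡⟨ ℕ→ℚ-sum size (λ k → (n C suc (toℕ k)) ℕ.* numPaths P (suc (toℕ k))) ⟩
    ∑[ k < size ] ℕ→ℚ ((n C suc (toℕ k)) ℕ.* numPaths P (suc (toℕ k)))
      ≡⟨ sum-cong-≗ {size} (λ k → trans (ℕ→ℚ-* (n C suc (toℕ k)) (numPaths P (suc (toℕ k))))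
                                        (ℚ.*-comm (ℕ→ℚ (n C suc (toℕ k))) (ℕ→ℚ (numPaths P (suc (toℕ k)))))) ⟩
    binomialSum n
      ∎
    where
    open ≡-Reasoning
    coefficient : ∀ n → ∑₁^∞ (numMultipaths P) n ≡ ℕ→ℚ (numMultipaths P n)
    -- The series `∑₁^∞` has constant term `0ℚ` by definition, which matches the absence of
    -- multi-paths of length 0.
    coefficient zero    = cong ℕ→ℚ (sym (numMultipaths-zero P))
    coefficient (suc n) = refl

  annihilated-binomialSum : Annihilated (suc size) binomialSum
  annihilated-binomialSum = annihilated-sum size
    {λ i n → ℕ→ℚ (numPaths P (suc i)) ℚ.* ℕ→ℚ (n C suc i)}
    (λ i i<size → annihilated-scale (ℕ→ℚ (numPaths P (suc i)))
      (annihilated-≤ (s≤s i<size) (annihilated-C (suc i))))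

  ẽ≗multipathSeries : ∀ Ω → IsOrderPolynomial P Ω → ẽ Ω ≗ ∑₁^∞ (numMultipaths P)
  ẽ≗multipathSeries Ω isΩ (suc n) =
    trans (isΩ (suc n)) (cong ℕ→ℚ (numOmegaOrderPreserving≡numMultipaths P (suc n)))
  -- `IsOrderPolynomial` says nothing at 0, so this value is extrapolated from the positive ones.
  -- The order `length Ω + suc size` is a common upper bound for the orders of the two sequences.
  ẽ≗multipathSeries Ω isΩ zero    = annihilated-extend
    (annihilated-≤ (ℕ.m≤m+n (length Ω) (suc size)) (annihilated-eval Ω))
    (annihilated-≤ (ℕ.m≤n+m (suc size) (length Ω))
      (annihilated-cong (λ n → sym (multipathSeries≗binomialSum n)) annihilated-binomialSum))
    (λ n → ẽ≗multipathSeries Ω isΩ (suc n))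

  open import Relation.Binary.Reasoning.Setoid setoid

  private
    G = 1/[1-X]
    H = X ⊛ 1/[1-X]
    c = numPaths P

  multipathSeries≗pathSeries : ∑₁^∞ (numMultipaths P) ≗ G ⊛ ∑₁ size (λ k → c k · H ^ k)
  multipathSeries≗pathSeries = begin
    ∑₁^∞ (numMultipaths P)                     ≈⟨ multipathSeries≗binomialSum ⟩
    binomialSum                                ≈⟨ ∑₁-·-cong size c (λ k → G ⊛ H ^ k) (λ k n → ℕ→ℚ (n C k))
                                                    (λ k _ → 1/[1-X]⊛[X/[1-X]]^k k) ⟨
    ∑₁ size (λ k → c k · (G ⊛ H ^ k))          ≈⟨ ⊛-linear G size c (H ^_) ⟨
    G ⊛ ∑₁ size (λ k → c k · H ^ k)            ∎

  eulerian≗ : ∀ Ω → IsOrderPolynomial P Ω →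
              eulerian P Ω ≗ ∑₁ size (λ k → c k · (X ^ k ⊛ (𝟙 ⊖ X) ^ (size ∸ k)))
  eulerian≗ Ω isΩ = begin
    U ⊛ ẽ Ω                                            ≈⟨ ⊛-congˡ {U} (ẽ≗multipathSeries Ω isΩ) ⟩
    U ⊛ ∑₁^∞ (numMultipaths P)                         ≈⟨ ⊛-congˡ {U} multipathSeries≗pathSeries ⟩
    U ⊛ (G ⊛ ∑₁ size (λ k → c k · H ^ k))              ≈⟨ ⊛-congˡ {U} (⊛-linear G size c (H ^_)) ⟩
    U ⊛ ∑₁ size (λ k → c k · (G ⊛ H ^ k))              ≈⟨ ⊛-linear U size c (λ k → G ⊛ H ^ k) ⟩
    ∑₁ size (λ k → c k · (U ⊛ (G ⊛ H ^ k)))            ≈⟨ ∑₁-·-cong size c (λ k → U ⊛ (G ⊛ H ^ k))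
                                                            (λ k → X ^ k ⊛ (𝟙 ⊖ X) ^ (size ∸ k)) (λ k → [1-X]^[1+s]-cancel) ⟩
    ∑₁ size (λ k → c k · (X ^ k ⊛ (𝟙 ⊖ X) ^ (size ∸ k))) ∎
    where
    U = (𝟙 ⊖ X) ^ suc size

corollary2p15 : (P : LabeledPoset) → let open LabeledPoset P in
    .{{_ : NonZero size}} →
    (Ω : Polynomial) → IsOrderPolynomial P Ω →
    (ẽ Ω ≗ ∑₁^∞ (numMultipaths P)) ×
    (∑₁^∞ (numMultipaths P) ≗
    1/[1-X] ⊛ ∑₁ size (λ k → numPaths P k · (X ⊛ 1/[1-X]) ^ k)) ×
    (eulerian P Ω ≗
    ∑₁ size (λ k → numPaths P k · (X ^ k ⊛ (𝟙 ⊖ X) ^ (size ∸ k))))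
corollary2p15 P Ω isΩ =
  ẽ≗multipathSeries P Ω isΩ , multipathSeries≗pathSeries P , eulerian≗ P Ω isΩ
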